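{- Let $$S=\{5,10,15,20,25,30,35,40,45,50,70,75,3,37,4,21,6,74,8,42,12,63,13,47,29,46,33,67,34,51,39,56,43,77,44,61,48,82,49,66,64,81\},$$ $$T=\{5,10,15,20,25,30,35,40,50,55,70,75,2,53,9,26,12,63,13,47,14,31,18,52,24,41,28,62,32,83,34,51,38,72,43,77,44,61,59,76,64,81\},$$ viewed as subsets of $\mathbb{Z}_{85}=\{0,1,\ldots,84\}$. Define $\mathbf a,\mathbf b\in\{ -1,1\}^{85}$ by $a_i=-1$ if $i\in S$ and $a_i=1$ otherwise, and $b_i=-1$ if $i\in T$ and $b_i=1$ otherwise. Then $(\mathbf a,\mathbf b)$ is a Legendre pair of length $85$, and $\{1,69\}\subseteq \widehat G_{\mathbf a}$ and $\{1,69\}\subseteq\widehat G_{\mathbf b}$. In particular, a Legendre pair of length $85$ exists.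
   Context: For $\mathbf a\in\mathbb{R}^\ell$ indexed by $\mathbb{Z}_\ell$, the periodic autocorrelation function is $\mathrm{PAF}_{\mathbf a}(j)=\sum_{i=0}^{\ell-1}a_i a_{i-j}$ (indices mod $\ell$). A pair $(\mathbf a,\mathbf b)$ of vectors in $\{ -1,1\}^\ell$ is a Legendre pair of length $\ell$ if $\mathrm{PAF}_{\mathbf a}(j)+\mathrm{PAF}_{\mathbf b}(j)=-2$ for all $j\in\mathbb{Z}_\ell\setminus\{0\}$ and $\sum_i a_i=\sum_i b_i$. For $k\in\mathbb{Z}_\ell^\times$ the decimation $d_k$ acts on vectors by $(d_k(\mathbf a))_i=a_{k^{ -1}i}$, and $\widehat G_{\mathbf a}=\{k\in\mathbb{Z}_\ell^\times\mid d_k(\mathbf a)=\mathbf a\}$. -}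

module Defs where

open import Algebra.Definitions using (Invertible)
open import Data.Bool.Base using (if_then_else_)
open import Data.Fin.Base using (Fin; toℕ)
open import Data.Fin.Subset using (Subset; ⋃; ⁅_⁆)
open import Data.Fin.Subset.Properties using (_∈?_)
open import Data.Integer.Base as ℤ using (ℤ; -1ℤ; 1ℤ)
open import Data.Integer.Properties using (+-0-commutativeMonoid)
open import Data.List.Base using (List; []; _∷_; map)
open import Data.Nat.Base as ℕ using (ℕ; NonZero; _∸_)
open import Data.Nat.DivMod using (_mod_)
open import Data.Product.Base using (Σ; _,_)
open import Data.Sum.Base using (_⊎_)
open import Data.Vec.Functional using (Vector)
open import Function.Base using (_∘_)
open import Level using (0ℓ)
open import Relation.Binary.PropositionalEquality.Core using (_≡_; _≢_; _≗_)
open import Relation.Nullary.Decidable.Core using (does)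
open import Relation.Unary using (Pred)
open import Algebra.Properties.CommutativeMonoid.Sum +-0-commutativeMonoid using (sum)

-- ℤ_ℓ is represented by Fin ℓ, with arithmetic on the least residues.
module _ {ℓ : ℕ} .{{_ : NonZero ℓ}} where

  0# 1# : Fin ℓ
  0# = 0 mod ℓ
  1# = 1 mod ℓ

  infixl 6 _-_
  infixl 7 _*_

  _-_ : Fin ℓ → Fin ℓ → Fin ℓ
  i - j = (toℕ i ℕ.+ (ℓ ∸ toℕ j)) mod ℓ

  _*_ : Fin ℓ → Fin ℓ → Fin ℓ
  i * j = (toℕ i ℕ.* toℕ j) mod ℓ

  Unit : Pred (Fin ℓ) 0ℓ
  Unit = Invertible _≡_ 1# _*_

  -- Vectors are integer-valued rather than real: PAF is only ever applied to
  -- ±1-valued vectors, for which all the sums involved are integers.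
  PAF : Vector ℤ ℓ → Fin ℓ → ℤ
  PAF a j = sum (λ i → a i ℤ.* a (i - j))

  ±1-Valued : Pred (Vector ℤ ℓ) 0ℓ
  ±1-Valued a = ∀ i → a i ≡ -1ℤ ⊎ a i ≡ 1ℤ

  record IsLegendrePair (a b : Vector ℤ ℓ) : Set where
    field
      a-±1    : ±1-Valued a
      b-±1    : ±1-Valued b
      PAF-sum : ∀ j → j ≢ 0# → PAF a j ℤ.+ PAF b j ≡ ℤ.- (ℤ.+ 2)
      sum-eq  : sum a ≡ sum b

  -- The inverse of k is unique, so this does not depend on the proof of Unit k.
  decimate : (k : Fin ℓ) → Unit k → Vector ℤ ℓ → Vector ℤ ℓ
  decimate k (k⁻¹ , _) a i = a (k⁻¹ * i)

  Ĝ : Vector ℤ ℓ → Pred (Fin ℓ) 0ℓ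
  Ĝ a k = Σ (Unit k) λ k-unit → decimate k k-unit a ≗ a

residues : ∀ {ℓ} .{{_ : NonZero ℓ}} → List ℕ → Subset ℓ
residues {ℓ} = ⋃ ∘ map (λ n → ⁅ n mod ℓ ⁆)

-1-on_ : ∀ {ℓ} → Subset ℓ → Vector ℤ ℓ
(-1-on P) i = if does (i ∈? P) then -1ℤ else 1ℤ

S T : Subset 85
S = residues
  ( 5 ∷ 10 ∷ 15 ∷ 20 ∷ 25 ∷ 30 ∷ 35 ∷ 40 ∷ 45 ∷ 50 ∷ 70 ∷ 75
  ∷ 3 ∷ 37 ∷ 4 ∷ 21 ∷ 6 ∷ 74 ∷ 8 ∷ 42 ∷ 12 ∷ 63 ∷ 13 ∷ 47 ∷ 29 ∷ 46
  ∷ 33 ∷ 67 ∷ 34 ∷ 51 ∷ 39 ∷ 56 ∷ 43 ∷ 77 ∷ 44 ∷ 61 ∷ 48 ∷ 82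
  ∷ 49 ∷ 66 ∷ 64 ∷ 81 ∷ [])
T = residues
  ( 5 ∷ 10 ∷ 15 ∷ 20 ∷ 25 ∷ 30 ∷ 35 ∷ 40 ∷ 50 ∷ 55 ∷ 70 ∷ 75
  ∷ 2 ∷ 53 ∷ 9 ∷ 26 ∷ 12 ∷ 63 ∷ 13 ∷ 47 ∷ 14 ∷ 31 ∷ 18 ∷ 52 ∷ 24 ∷ 41
  ∷ 28 ∷ 62 ∷ 32 ∷ 83 ∷ 34 ∷ 51 ∷ 38 ∷ 72 ∷ 43 ∷ 77 ∷ 44 ∷ 61
  ∷ 59 ∷ 76 ∷ 64 ∷ 81 ∷ [])

𝐚 𝐛 : Vector ℤ 85
𝐚 = -1-on S
𝐛 = -1-on T

{-# OPTIONS --safe #-}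
module Submission where

open import Defs
open import Data.Fin using (#_)
open import Data.Integer.Base using (ℤ)
open import Data.Product.Base using (_×_; ∃₂)
open import Data.Vec.Functional using (Vector)
open import Relation.Unary using (｛_｝; _∪_; _⊆_)

open import Algebra.Properties.CommutativeMonoid.Sum using (sum-cong-≗)
import Data.Fin.Properties as Fin
open import Data.Fin.Subset using (Subset)
open import Data.Fin.Subset.Properties using (_∈?_)
open import Data.Integer.Base using (+_; -_; _+_) renaming (_*_ to _*ℤ_)
open import Data.Integer.Properties using (+-0-commutativeMonoid; _≟_)
open import Data.Nat.Base using (NonZero)
open import Data.Product.Base using (_,_)
open import Data.Sum.Base using (inj₁; inj₂)
open import Data.Unit.Base using (tt)
open import Data.Vec.Base using (Vec; lookup; tabulate)
open import Data.Vec.Properties using (lookup∘tabulate)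
open import Relation.Binary.PropositionalEquality
  using (_≡_; _≢_; _≗_; refl; sym; trans; cong₂)
open import Relation.Nullary.Decidable
  using (Dec; yes; no; True; toWitness; ¬?; _→-dec_; from-yes)

-- The pair is explicit, so everything is a finite computation: one identity for each of the 84
-- nonzero shifts, and one equality per index for each decimation. Symmetry has a structural reason:
-- 69 is 1 mod 17 and -1 mod 5, so multiplication by 69 is an involution of the residues mod 85
-- fixing exactly the multiples of 5. `S` and `T` each consist of 12 such fixed points and 15 orbits
-- of size two. The autocorrelations are evaluated on tables of the entries; `PAF-cong` carries the
-- result back to `𝐚` and `𝐛`.

PAF-cong : ∀ {ℓ} .{{_ : NonZero ℓ}} {a b : Vector ℤ ℓ} → a ≗ b → PAF a ≗ PAF b
PAF-cong a≗b j =
  sum-cong-≗ +-0-commutativeMonoid (λ i → cong₂ _*ℤ_ (a≗b i) (a≗b (i - j)))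

-1-on-±1 : ∀ {ℓ} .{{_ : NonZero ℓ}} (P : Subset ℓ) → ±1-Valued (-1-on P)
-1-on-±1 P i with i ∈? P
... | yes _ = inj₁ refl
... | no  _ = inj₂ refl

-- The condition on `j` belongs inside the decision: at shift zero, two ±1 vectors give twice the
-- length instead of -2.
PAF-sum? : ∀ {ℓ} .{{_ : NonZero ℓ}} (v w : Vec ℤ ℓ) →
  Dec (∀ j → j ≢ 0# → PAF (lookup v) j + PAF (lookup w) j ≡ - (+ 2))
PAF-sum? v w = Fin.all? λ j →
  ¬? (j Fin.≟ 0#) →-dec (PAF (lookup v) j + PAF (lookup w) j ≟ - (+ 2))

-- Tabulating lets the evaluator compute each entry of a and b only once.
PAF-sum-by-tabulation : ∀ {ℓ} .{{_ : NonZero ℓ}} (a b : Vector ℤ ℓ) →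
  True (PAF-sum? (tabulate a) (tabulate b)) →
  ∀ j → j ≢ 0# → PAF a j + PAF b j ≡ - (+ 2)
PAF-sum-by-tabulation a b holds j j≢0 = trans
  (sym (cong₂ _+_ (PAF-cong (lookup∘tabulate a) j) (PAF-cong (lookup∘tabulate b) j)))
  (toWitness holds j j≢0)

_≗?_ : ∀ {ℓ} (a b : Vector ℤ ℓ) → Dec (a ≗ b)
a ≗? b = Fin.all? λ i → a i ≟ b i

𝐚𝐛-PAF-sum : ∀ j → j ≢ 0# → PAF 𝐚 j + PAF 𝐛 j ≡ - (+ 2)
-- `tt` typechecks only because the decision evaluates to `yes`, which verifies all 84 identities.
𝐚𝐛-PAF-sum = PAF-sum-by-tabulation 𝐚 𝐛 tt

𝐚𝐛-isLegendrePair : IsLegendrePair 𝐚 𝐛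
𝐚𝐛-isLegendrePair = record
  { a-±1    = -1-on-±1 S
  ; b-±1    = -1-on-±1 T
  ; PAF-sum = 𝐚𝐛-PAF-sum
  -- Both sums evaluate to 43 - 42 = 1, as `S` and `T` have 42 elements each.
  ; sum-eq  = refl
  }

1-unit : Unit {85} (# 1)
1-unit = # 1 , refl , refl

69-unit : Unit {85} (# 69)
-- 69 is its own inverse: 69 * 69 = 4761 = 56 * 85 + 1.
69-unit = # 69 , refl , refl

mainTheorem1 : IsLegendrePair 𝐚 𝐛
    × ｛ # 1 ｝ ∪ ｛ # 69 ｝ ⊆ Ĝ 𝐚
    × ｛ # 1 ｝ ∪ ｛ # 69 ｝ ⊆ Ĝ 𝐛
    × ∃₂ λ (a b : Vector ℤ 85) → IsLegendrePair a b
mainTheorem1 =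
    𝐚𝐛-isLegendrePair
  , (λ { (inj₁ refl) → 1-unit  , from-yes (decimate (# 1)  1-unit  𝐚 ≗? 𝐚)
       ; (inj₂ refl) → 69-unit , from-yes (decimate (# 69) 69-unit 𝐚 ≗? 𝐚) })
  , (λ { (inj₁ refl) → 1-unit  , from-yes (decimate (# 1)  1-unit  𝐛 ≗? 𝐛)
       ; (inj₂ refl) → 69-unit , from-yes (decimate (# 69) 69-unit 𝐛 ≗? 𝐛) })
  , 𝐚 , 𝐛 , 𝐚𝐛-isLegendrePair
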